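{- Let $n,m\ge 1$, let $g_1,\ldots,g_m$ be computable functions from $\mathbb{Z}^{n+1}$ to $\mathbb{Z}^n$, and let $PROG=(S,I,R)$ be the while-loop program with vector of variables $\vec x=(x[1],\ldots,x[n])$ determined by $g_1,\ldots,g_m$. Let $f_1(\vec x),\ldots,f_M(\vec x)$ be functions from $\mathbb{Z}^n$ to $\mathbb{N}$, and let $C_1,\ldots,C_m$ be the $M\times M$ matrices, with entries in $\mathbb{Z}\cup\{\infty\}$, associated to $f_1,\ldots,f_M$ and the cases $\mathrm{control}=1,\ldots,\mathrm{control}=m$. If every (finite, nonempty, repetitions allowed) product of the matrices $C_1,\ldots,C_m$ has a negative number on the diagonal, then the program terminates, i.e., every computation of $PROG$ is finite.
   Context: $\mathbb{N}=\{0,1,2,\ldots\}$. The while-loop program determined by $g_1,\ldots,g_m:\mathbb{Z}^{n+1}\to\mathbb{Z}^n$ is the following. The state is $X=(x[1],\ldots,x[n])\in\mathbb{Z}^n$; initially $X$ is an arbitrary element of $\mathbb{Z}^n$ supplied by the user. While $x[1]>0$ and $x[2]>0$ and $\cdots$ and $x[n]>0$, the user chooses $\mathrm{control}=i\in\{1,\ldots,m\}$ and an integer $u\in\mathbb{Z}$, and $X$ is replaced by $g_i(X,u)$. Formally $S=I=\mathbb{Z}^n$, and $R(s,t)$ holds iff all coordinates of $s$ are positive and there exist $i\in\{1,\ldots,m\}$ and $u\in\mathbb{Z}$ with $t=g_i(s,u)$. A computation is a finite or infinite sequence of states $s_1,s_2,\ldots$ with $s_1\in I$, with $R(s_i,s_{i+1})$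 for all consecutive terms, and such that if the sequence is finite with last state $s$ then there is no $t$ with $R(s,t)$. The matrix $C_\ell$ associated to $f_1,\ldots,f_M$ and $\mathrm{control}=\ell$ records what is known about one execution of that case: its $(i,j)$ entry is the difference (new value of $f_j(\vec x)$) minus (old value of $f_i(\vec x)$) if this difference is known, and $\infty$ if it is not known. That is, each entry $C_\ell[i,j]$ is either $\infty$, or an integer $d$ such that for every state $X$ satisfying the loop condition and every $u\in\mathbb{Z}$, $f_j(g_\ell(X,u))=f_i(X)+d$. The product of two $M\times M$ matrices $A=(a_{ij})$, $B=(b_{ij})$ over $\mathbb{Z}\cup\{\infty\}$ is the nonstandard (min-plus) product $AB[i,j]=\min_{1\le k\le M}\{a_{ik}+b_{kj}\}$, where $\infty+x=x+\infty=\infty$ for all $x\in\mathbb{Z}\cup\{\infty\}$. -}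

module Defs where

open import Data.Fin.Base using (Fin)
open import Data.Integer.Base as ℤ using (ℤ; +_; -[1+_]; 0ℤ)
open import Data.List.NonEmpty.Base as List⁺ using (List⁺)
open import Data.Maybe.Base using (Maybe; just; nothing)
open import Data.Nat.Base as ℕ using (ℕ; zero; suc)
open import Data.Product.Base using (∃; ∃₂; _×_)
open import Data.Vec.Base using (Vec; []; _∷_; _∷ʳ_; map; lookup)
import Data.Vec.Functional as Vector
open import Data.Vec.Relation.Binary.Pointwise.Inductive using (Pointwise)
open import Data.Vec.Relation.Unary.All using (All)
open import Level using (0ℓ)
open import Relation.Binary.Core using (Rel)
open import Relation.Binary.PropositionalEquality.Core using (_≡_)
open import Relation.Nullary.Construct.Add.Supremum using (_⁺; [_]; ⊤⁺)
open import Relation.Nullary.Negation.Core using (¬_)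
open import Relation.Unary using (Pred; U)

-- Computability is μ-recursiveness: descriptions of partial recursive
-- functions, with their graphs as a big-step evaluation relation.

data Rec : ℕ → Set where
  zer  : Rec 0
  succ : Rec 1
  proj : ∀ {k} → Fin k → Rec k
  comp : ∀ {j k} → Rec j → Vec (Rec k) j → Rec k
  prec : ∀ {k} → Rec k → Rec (suc (suc k)) → Rec (suc k)
  mu   : ∀ {k} → Rec (suc k) → Rec k

infix 4 _⟨_⟩⇓_

data _⟨_⟩⇓_ : ∀ {k} → Rec k → Vec ℕ k → ℕ → Set where
  ⇓zer   : zer ⟨ [] ⟩⇓ 0
  ⇓succ  : ∀ {x} → succ ⟨ x ∷ [] ⟩⇓ suc x
  ⇓proj  : ∀ {k} {i : Fin k} {xs} → proj i ⟨ xs ⟩⇓ lookup xs i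
  ⇓comp  : ∀ {j k} {h : Rec j} {es : Vec (Rec k) j} {xs ys z} →
           Pointwise (λ e y → e ⟨ xs ⟩⇓ y) es ys → h ⟨ ys ⟩⇓ z →
           comp h es ⟨ xs ⟩⇓ z
  ⇓prec₀ : ∀ {k} {b : Rec k} {h xs z} →
           b ⟨ xs ⟩⇓ z → prec b h ⟨ zero ∷ xs ⟩⇓ z
  ⇓precₛ : ∀ {k} {b : Rec k} {h x xs y z} →
           prec b h ⟨ x ∷ xs ⟩⇓ y → h ⟨ x ∷ y ∷ xs ⟩⇓ z →
           prec b h ⟨ suc x ∷ xs ⟩⇓ z
  ⇓mu    : ∀ {k} {h : Rec (suc k)} {xs y} →
           (∀ x → x ℕ.< y → ∃ λ v → h ⟨ x ∷ xs ⟩⇓ suc v) →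
           h ⟨ y ∷ xs ⟩⇓ 0 → mu h ⟨ xs ⟩⇓ y

-- The usual bijection 0, -1, 1, -2, 2, … ↦ 0, 1, 2, 3, 4, …
code : ℤ → ℕ
code (+ k)    = 2 ℕ.* k
code -[1+ k ] = suc (2 ℕ.* k)

Computable : ∀ {k l} → (Vec ℤ k → Vec ℤ l) → Set
Computable {k} {l} g = ∃ λ (es : Vec (Rec k) l) →
  ∀ xs → Pointwise (λ e y → e ⟨ map code xs ⟩⇓ code y) es (g xs)

record Program : Set₁ where
  field
    State : Set
    Init  : Pred State 0ℓ
    Step  : Rel State 0ℓ

-- A finite or infinite sequence is a partial function on ℕ whose domain is an
-- initial segment (ensured by the field `step`); indices start at 0.
record Computation (P : Program) : Set where
  open Program P
  field
    seq     : ℕ → Maybe State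
    start   : ∃ λ s → seq 0 ≡ just s × Init s
    step    : ∀ k {t} → seq (suc k) ≡ just t →
              ∃ λ s → seq k ≡ just s × Step s t
    maximal : ∀ k {s} → seq k ≡ just s → seq (suc k) ≡ nothing →
              ¬ (∃ λ t → Step s t)

IsFinite : ∀ {P} → Computation P → Set
IsFinite c = ∃ λ k → Computation.seq c k ≡ nothing

Terminates : Program → Set
Terminates P = (c : Computation P) → IsFinite c

LoopCondition : ∀ {n} → Vec ℤ n → Set
LoopCondition = All (0ℤ ℤ.<_)

whileLoop : ∀ {n m} → (Fin m → Vec ℤ (suc n) → Vec ℤ n) → Program
whileLoop {n} g = record
  { State = Vec ℤ n
  ; Init  = U
  ; Step  = λ s t → LoopCondition s × ∃₂ λ i u → t ≡ g i (s ∷ʳ u)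
  }

ℤ∞ : Set
ℤ∞ = ℤ ⁺

pattern ∞ = ⊤⁺

infixl 6 _+∞_
infixl 7 _⊓∞_ _⊗_

_+∞_ : ℤ∞ → ℤ∞ → ℤ∞
[ a ] +∞ [ b ] = [ a ℤ.+ b ]
[ _ ] +∞ ∞     = ∞
∞     +∞ _     = ∞

_⊓∞_ : ℤ∞ → ℤ∞ → ℤ∞
[ a ] ⊓∞ [ b ] = [ a ℤ.⊓ b ]
[ a ] ⊓∞ ∞     = [ a ]
∞     ⊓∞ y     = y

Matrix : ℕ → Set
Matrix M = Fin M → Fin M → ℤ∞

_⊗_ : ∀ {M} → Matrix M → Matrix M → Matrix M
(A ⊗ B) i j = Vector.foldr _⊓∞_ ∞ (λ k → A i k +∞ B k j)

product : ∀ {M m} → (Fin m → Matrix M) → List⁺ (Fin m) → Matrix M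
product C w = List⁺.foldr₁ _⊗_ (List⁺.map C w)

HasNegativeDiagonalEntry : ∀ {M} → Matrix M → Set
HasNegativeDiagonalEntry A = ∃₂ λ i d → A i i ≡ [ d ] × d ℤ.< 0ℤ

-- `∞` means "not known", so it carries no constraint.
Associated : ∀ {n M} → (Fin M → Vec ℤ n → ℕ) → (Vec ℤ (suc n) → Vec ℤ n) →
             Matrix M → Set
Associated f gℓ Cℓ = ∀ i j d → Cℓ i j ≡ [ d ] →
  ∀ X → LoopCondition X → ∀ u → + f j (gℓ (X ∷ʳ u)) ≡ + f i X ℤ.+ d

{-# OPTIONS --safe #-}

-- A finite entry (i , j) of a product of the matrices along a segment of a
-- computation is the exact change from f_i before the segment to f_j after it.
-- A negative diagonal entry therefore says that some f_i strictly decreases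
-- between any two moments a < b.  By Dickson's lemma no infinite sequence of
-- vectors in ℕ^M behaves like that.  To obtain an actual index at which the
-- computation has stopped, Dickson's lemma is proved constructively, through
-- the closure of almost-full relations (Vytiniotis, Coquand, Wahlstedt) under
-- intersection.

module Submission where

open import Defs
open import Data.Empty.Polymorphic using (⊥)
open import Data.Fin.Base using (Fin; zero; suc)
open import Data.Integer.Base as ℤ using (ℤ; +_)
import Data.Integer.Properties as ℤ
open import Data.List.NonEmpty.Base using (List⁺; _∷⁺_) renaming ([_] to [_]⁺)
open import Data.Maybe.Base using (just; nothing; maybe)
open import Data.Nat.Base using (ℕ; zero; suc; _≤_; _<_; z≤n; s≤s; _≤‴_; ≤‴-refl; ≤‴-step)
open import Data.Nat.Properties using (≤-refl; ≤-trans; <⇒≱; <-≤-connex; ≤⇒≤‴)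
open import Data.Product.Base using (∃; ∃₂; _×_; _,_)
open import Data.Sum.Base using (_⊎_; inj₁; inj₂; [_,_]′; map₁)
open import Data.Vec.Base using (Vec)
import Data.Vec.Functional as Vector
open import Function.Base using (_∘_; _on_; id)
open import Level using (Level; _⊔_; 0ℓ) renaming (suc to lsuc)
open import Relation.Binary.Core using (Rel; _⇒_)
open import Relation.Binary.PropositionalEquality using (_≡_; refl; sym; trans; cong; subst; module ≡-Reasoning)
open import Relation.Nullary.Construct.Add.Supremum using ([_])
open import Relation.Nullary.Negation.Core using (contradiction)

private
  variable
    a ℓ : Level
    X Y : Set a
    n m M : ℕ

-- Inductive form of "every infinite sequence has a good pair": `later` records a seen point `x`,
-- and a pair then also counts as good if its first member is related to `x`.
data AlmostFull {X : Set a} (R : Rel X ℓ) : Set (a ⊔ lsuc ℓ) where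
  now   : (∀ x y → R x y) → AlmostFull R
  later : (∀ x → AlmostFull (λ y z → R y z ⊎ R x y)) → AlmostFull R

almostFull-mono : {R S : Rel X ℓ} → R ⇒ S → AlmostFull R → AlmostFull S
almostFull-mono R⇒S (now r)   = now λ x y → R⇒S (r x y)
almostFull-mono R⇒S (later r) =
  later λ x → almostFull-mono [ inj₁ ∘ R⇒S , inj₂ ∘ R⇒S ]′ (r x)

almostFull-on : {R : Rel Y ℓ} (f : X → Y) → AlmostFull R → AlmostFull (R on f)
almostFull-on f (now r)   = now λ x y → r (f x) (f y)
almostFull-on f (later r) = later λ x → almostFull-on f (r (f x))

almostFull⇒goodPair : {R : Rel X ℓ} → AlmostFull R → (x : ℕ → X) →
                      ∃₂ λ i j → i < j × R (x i) (x j)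
almostFull⇒goodPair (now r)   x = 0 , 1 , ≤-refl , r _ _
almostFull⇒goodPair (later r) x with almostFull⇒goodPair (r (x 0)) (x ∘ suc)
... | i , j , i<j , inj₁ p = suc i , suc j , s≤s i<j , p
-- This alternative relates the recorded point `x 0` to the earlier member of the pair, so `j` is
-- dropped.
... | i , j , i<j , inj₂ p = 0 , suc i , s≤s z≤n , p

private
  both : {A B C : Set ℓ} → A ⊎ B → A ⊎ C → A ⊎ (B × C)
  both (inj₁ x) _        = inj₁ x
  both (inj₂ _) (inj₁ x) = inj₁ x
  both (inj₂ y) (inj₂ z) = inj₂ (y , z)

-- Intersection is built up by arity: first for disjuncts C, D that are
-- propositions, then unary predicates, then binary relations; each case
-- uses the previous one with the point x supplied by `later` fixed.

almostFull-×₀ : {R S T : Rel X ℓ} {C D : Set ℓ} → AlmostFull R → AlmostFull S →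
                (∀ {y z} → R y z → T y z ⊎ C) → (∀ {y z} → S y z → T y z ⊎ D) →
                AlmostFull (λ y z → T y z ⊎ (C × D))
almostFull-×₀ (now r) s R⇒ S⇒ = almostFull-mono (λ p → both (R⇒ (r _ _)) (S⇒ p)) s
almostFull-×₀ {T = T} {C} {D} (later r) s R⇒ S⇒ = later λ x →
  almostFull-mono
    [ [ inj₁ ∘ inj₁ , inj₂ ∘ inj₁ ]′ , inj₁ ∘ inj₂ ]′
    (almostFull-×₀ {T = λ y z → T y z ⊎ T x y} {C} {D} (r x) s
      [ map₁ inj₁ ∘ R⇒ , map₁ inj₂ ∘ R⇒ ]′
      (map₁ inj₁ ∘ S⇒))

almostFull-×₁ : {R S T : Rel X ℓ} {C D : X → Set ℓ} → AlmostFull R → AlmostFull S →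
                (∀ {y z} → R y z → T y z ⊎ C y) → (∀ {y z} → S y z → T y z ⊎ D y) →
                AlmostFull (λ y z → T y z ⊎ (C y × D y))
almostFull-×₁ (now r) s R⇒ S⇒ = almostFull-mono (λ p → both (R⇒ (r _ _)) (S⇒ p)) s
almostFull-×₁ r@(later _) (now s) R⇒ S⇒ =
  almostFull-mono (λ p → both (R⇒ p) (S⇒ (s _ _))) r
almostFull-×₁ {T = T} {C} {D} r@(later r′) s@(later s′) R⇒ S⇒ = later λ x →
  almostFull-mono
    [ [ [ inj₁ ∘ inj₁ , inj₂ ∘ inj₁ ]′ , inj₁ ∘ inj₂ ]′ , inj₂ ∘ inj₂ ]′
    (almostFull-×₀
      {T = λ y z → (T y z ⊎ T x y) ⊎ (C y × D y)} {C x} {D x}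
      (almostFull-×₁ {T = λ y z → (T y z ⊎ T x y) ⊎ C x} {C} {D} (r′ x) s
        [ map₁ (inj₁ ∘ inj₁) ∘ R⇒ , inj₁ ∘ map₁ inj₂ ∘ R⇒ ]′
        (map₁ (inj₁ ∘ inj₁) ∘ S⇒))
      (almostFull-×₁ {T = λ y z → (T y z ⊎ T x y) ⊎ D x} {C} {D} r (s′ x)
        (map₁ (inj₁ ∘ inj₁) ∘ R⇒)
        [ map₁ (inj₁ ∘ inj₁) ∘ S⇒ , inj₁ ∘ map₁ inj₂ ∘ S⇒ ]′)
      [ map₁ inj₁ , inj₁ ∘ inj₂ ]′
      [ map₁ inj₁ , inj₁ ∘ inj₂ ]′)

almostFull-×₂ : {R S T A B : Rel X ℓ} → AlmostFull R → AlmostFull S →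
                (∀ {y z} → R y z → T y z ⊎ A y z) → (∀ {y z} → S y z → T y z ⊎ B y z) →
                AlmostFull (λ y z → T y z ⊎ (A y z × B y z))
almostFull-×₂ (now r) s R⇒ S⇒ = almostFull-mono (λ p → both (R⇒ (r _ _)) (S⇒ p)) s
almostFull-×₂ r@(later _) (now s) R⇒ S⇒ =
  almostFull-mono (λ p → both (R⇒ p) (S⇒ (s _ _))) r
almostFull-×₂ {T = T} {A} {B} r@(later r′) s@(later s′) R⇒ S⇒ = later λ x →
  almostFull-mono
    [ [ [ inj₁ ∘ inj₁ , inj₂ ∘ inj₁ ]′ , inj₁ ∘ inj₂ ]′ , inj₂ ∘ inj₂ ]′
    -- One recursive call advances `r` and leaves `A x y` as an extra alternative, the other
    -- advances `s` and leaves `B x y`. For fixed `x` both are unary in `y`.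
    (almostFull-×₁
      {T = λ y z → (T y z ⊎ T x y) ⊎ (A y z × B y z)} {A x} {B x}
      (almostFull-×₂ {T = λ y z → (T y z ⊎ T x y) ⊎ A x y} {A} {B} (r′ x) s
        [ map₁ (inj₁ ∘ inj₁) ∘ R⇒ , inj₁ ∘ map₁ inj₂ ∘ R⇒ ]′
        (map₁ (inj₁ ∘ inj₁) ∘ S⇒))
      (almostFull-×₂ {T = λ y z → (T y z ⊎ T x y) ⊎ B x y} {A} {B} r (s′ x)
        (map₁ (inj₁ ∘ inj₁) ∘ R⇒)
        [ map₁ (inj₁ ∘ inj₁) ∘ S⇒ , inj₁ ∘ map₁ inj₂ ∘ S⇒ ]′)
      [ map₁ inj₁ , inj₁ ∘ inj₂ ]′
      [ map₁ inj₁ , inj₁ ∘ inj₂ ]′)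

almostFull-∩ : {R S : Rel X ℓ} → AlmostFull R → AlmostFull S →
               AlmostFull (λ x y → R x y × S x y)
almostFull-∩ {R = R} {S} r s =
  almostFull-mono [ (λ ()) , id ]′
    -- The accumulator `T` of alternatives already won starts empty.
    (almostFull-×₂ {T = λ _ _ → ⊥} {R} {S} r s inj₂ inj₂)

almostFull-⋂ : (R : Fin n → Rel X ℓ) → (∀ i → AlmostFull (R i)) →
               AlmostFull (λ x y → ∀ i → R i x y)
almostFull-⋂ {n = zero}  R r = now λ _ _ ()
almostFull-⋂ {n = suc n} R r =
  almostFull-mono (λ { (p , q) zero → p ; (p , q) (suc i) → q i })
    (almostFull-∩ (r zero) (almostFull-⋂ (R ∘ suc) (r ∘ suc)))

-- Induction on the recorded point: a next point at least as large completes a good pair, and a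
-- smaller one takes over as the bound, which can drop only finitely often.
≤-almostFull : AlmostFull _≤_
≤-almostFull = later below
  where
  below : ∀ x → AlmostFull (λ y z → y ≤ z ⊎ x ≤ y)
  below zero    = now λ _ _ → inj₂ z≤n
  below (suc x) = later λ x′ → case x′ (<-≤-connex x x′)
    where
    case : ∀ x′ → suc x ≤ x′ ⊎ x′ ≤ x →
           AlmostFull (λ y z → (y ≤ z ⊎ suc x ≤ y) ⊎ (x′ ≤ y ⊎ suc x ≤ x′))
    case x′ (inj₁ x<x′) = now λ _ _ → inj₂ (inj₂ x<x′)
    case x′ (inj₂ x′≤x) =
      almostFull-mono [ inj₁ ∘ inj₁ , inj₂ ∘ inj₁ ∘ ≤-trans x′≤x ]′ (below x)

dickson : (F : Fin M → ℕ → ℕ) → ∃₂ λ a b → a < b × (∀ i → F i a ≤ F i b)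
dickson F = almostFull⇒goodPair
  -- The points are the indices themselves, enumerated by `id`.
  (almostFull-⋂ (λ i → _≤_ on F i) (λ i → almostFull-on (F i) ≤-almostFull)) id

⊓∞-sel : ∀ x y → x ⊓∞ y ≡ x ⊎ x ⊓∞ y ≡ y
⊓∞-sel [ a ] [ b ] with ℤ.⊓-sel a b
... | inj₁ p = inj₁ (cong [_] p)
... | inj₂ p = inj₂ (cong [_] p)
⊓∞-sel [ a ] ∞ = inj₁ refl
⊓∞-sel ∞     y = inj₂ refl

-- The empty minimum is `∞`, and `_⊓∞_` always selects an argument, so a finite value comes from an
-- actual entry.
⨅-attained : (v : Fin n → ℤ∞) {d : ℤ} →
             Vector.foldr _⊓∞_ ∞ v ≡ [ d ] → ∃ λ k → v k ≡ [ d ]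
⨅-attained {suc n} v eq
  with ⊓∞-sel (v zero) (Vector.foldr _⊓∞_ ∞ (v ∘ suc))
... | inj₁ p = zero , trans (sym p) eq
... | inj₂ p with ⨅-attained (v ∘ suc) (trans (sym p) eq)
...   | k , q = suc k , q

+∞-finite : ∀ x y {d} → x +∞ y ≡ [ d ] →
            ∃₂ λ a b → x ≡ [ a ] × y ≡ [ b ] × d ≡ a ℤ.+ b
+∞-finite [ a ] [ b ] refl = a , b , refl , refl , refl

module _ {S : Set} (f : Fin M → S → ℕ) where

  Describes : Matrix M → Rel S 0ℓ
  Describes A s t = ∀ i j d → A i j ≡ [ d ] → + f j t ≡ + f i s ℤ.+ d

  -- At a `k` attaining the minimum both summands are finite, and the two exact changes telescope
  -- through `f k t`.
  describes-⊗ : ∀ {A B s t u} → Describes A s t → Describes B t u →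
                Describes (A ⊗ B) s u
  describes-⊗ {A} {B} {s} {t} {u} As Bs i j d eq
    with ⨅-attained (λ k → A i k +∞ B k j) eq
  ... | k , eqₖ with +∞-finite (A i k) (B k j) eqₖ
  ...   | a , b , eqa , eqb , refl = begin
    + f j u                    ≡⟨ Bs k j b eqb ⟩
    + f k t ℤ.+ b              ≡⟨ cong (ℤ._+ b) (As i k a eqa) ⟩
    (+ f i s ℤ.+ a) ℤ.+ b      ≡⟨ ℤ.+-assoc (+ f i s) a b ⟩
    + f i s ℤ.+ (a ℤ.+ b)      ∎
    where open ≡-Reasoning

  negativeDiagonal⇒decrease : ∀ {A s t} → HasNegativeDiagonalEntry A →
                              Describes A s t → ∃ λ i → f i t < f i s
  negativeDiagonal⇒decrease {s = s} {t} (i , d , eq , d<0) As =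
    i , ℤ.drop‿+<+ (begin-strict
      + f i t              ≡⟨ As i i d eq ⟩
      + f i s ℤ.+ d        <⟨ ℤ.+-monoʳ-< (+ f i s) d<0 ⟩
      + f i s ℤ.+ + 0      ≡⟨ ℤ.+-identityʳ (+ f i s) ⟩
      + f i s              ∎)
    where open ℤ.≤-Reasoning

module _ (g : Fin m → Vec ℤ (suc n) → Vec ℤ n) (f : Fin M → Vec ℤ n → ℕ)
         (C : Fin m → Matrix M) (assoc : ∀ ℓ → Associated f (g ℓ) (C ℓ))
         (c : Computation (whileLoop g)) where

  open Computation c

  step-described : ∀ k {t} → seq (suc k) ≡ just t →
    ∃₂ λ ℓ s → seq k ≡ just s × Describes f (C ℓ) s t
  step-described k eq with step k eq
  ... | s , eqₛ , pos , ℓ , u , refl =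
    ℓ , s , eqₛ , λ i j d eq → assoc ℓ i j d eq s pos u

  -- `_≤‴_` recurses on its lower end, so segments grow at the front, matching the right fold in
  -- `product`.
  segment-described : ∀ {a b t} → suc a ≤‴ b → seq b ≡ just t →
    ∃₂ λ w s → seq a ≡ just s × Describes f (product C w) s t
  segment-described {a} ≤‴-refl eq with step-described a eq
  ... | ℓ , s , eqₛ , D = [ ℓ ]⁺ , s , eqₛ , D
  segment-described {a} (≤‴-step a<b) eq with segment-described a<b eq
  ... | w , s′ , eq′ , D′ with step-described a eq′
  ...   | ℓ , s , eqₛ , D = ℓ ∷⁺ w , s , eqₛ , describes-⊗ f D D′

theorem8p6 : ∀ (n m : ℕ) → 1 ≤ n → 1 ≤ m →
    (g : Fin m → Vec ℤ (suc n) → Vec ℤ n) →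
    (∀ ℓ → Computable (g ℓ)) →
    (M : ℕ) (f : Fin M → Vec ℤ n → ℕ) →
    (C : Fin m → Matrix M) →
    (∀ ℓ → Associated f (g ℓ) (C ℓ)) →
    (∀ (w : List⁺ (Fin m)) → HasNegativeDiagonalEntry (product C w)) →
    Terminates (whileLoop g)
theorem8p6 n m _ _ g _ M f C assoc neg c
  -- The default 0 is harmless: if term `b` is missing, the computation has stopped; otherwise term
  -- `a` exists too.
  with dickson (λ i k → maybe (f i) 0 (Computation.seq c k))
... | a , b , a<b , Fa≤Fb with Computation.seq c b in eq
...   | nothing = b , eq
...   | just t with segment-described g f C assoc c (≤⇒≤‴ a<b) eq
...     | w , s , eqₛ , D with negativeDiagonal⇒decrease f (neg w) D
...       | i , fit<fis =
  contradiction (subst (λ x → maybe (f i) 0 x ≤ f i t) eqₛ (Fa≤Fb i)) (<⇒≱ fit<fis)
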